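{- We have that $$p(n)=n+\nu(n)-1+\sum_{\mu\in \mathcal N_n\setminus (n)}(\mu_1-\mu_2),$$ with the right-hand sum taken over nuclear partitions $\mu=(\mu_1,\mu_2,\dots,\mu_r)$ of $n$ apart from the partition $(n)$.
   Context: $p(n)$ denotes the partition function, i.e. the number of integer partitions of $n\geq 0$, where $p(0):=1$. A nuclear partition is an integer partition having no part equal to one. $\mathcal N_n$ denotes the set of nuclear partitions of $n\geq 0$, and $(n)$ denotes the partition of $n$ into just one part; $\mathcal N_n\setminus (n)$ is the set of nuclear partitions of $n$ aside from $(n)$. For $n\geq 1$, $\nu(n)$ counts the number of nuclear partitions of $n$, with $\nu(0):=1$ (and $\nu(1)=0$). A nuclear partition is written $\mu=(\mu_1,\mu_2,\dots,\mu_r)$ with $\mu_1\geq\mu_2\geq\dots\geq\mu_r\geq 2$.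
   Formalization: The identity is stated for n ≥ 2: at n = 1 it fails (p(1) = 1 but the right-hand side is 1 + 0 − 1 + 0 = 0), and at n = 0 the difference μ₁ − μ₂ is undefined for the empty partition. -}

module Defs where

open import Data.Nat using (ℕ; zero; suc; _+_; _∸_; _≤_; _≥_; z≤n; s≤s; _≟_)
open import Data.Nat.Properties
  using (≤-refl; ≤-trans; m≤n⇒m≤1+n; 1+n≰n; m≤n⇒m<n∨m≡n; m≤m+n; m≤n+m;
         +-mono-≤; ≤-pred)
open import Data.List using (List; []; _∷_; [_]; _++_; map; filter; length)
open import Data.Nat.ListAction using (sum)
open import Data.List.Properties using (≡-dec; ∷-injective)
open import Data.List.Relation.Unary.All as All using (All; []; _∷_)
open import Data.List.Relation.Unary.AllPairs using ([]; _∷_)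
open import Data.List.Relation.Unary.Any using (here)
open import Data.List.Relation.Unary.Linked using (Linked; []; [-]; _∷_)
open import Data.List.Relation.Unary.Linked.Properties using (Linked⇒All)
open import Data.List.Relation.Unary.Unique.Propositional using (Unique)
import Data.List.Relation.Unary.Unique.Propositional.Properties as Unique
open import Data.List.Membership.Propositional using (_∈_)
open import Data.List.Membership.Propositional.Properties
  using (∈-++⁺ˡ; ∈-++⁺ʳ; ∈-++⁻; ∈-map⁺; ∈-map⁻; ∈-filter⁺; ∈-filter⁻)
open import Data.Product using (_×_; _,_; proj₂; ∃-syntax)
open import Data.Sum using (inj₁; inj₂)
open import Function.Bundles using (_⇔_; mk⇔; Equivalence)
open import Relation.Binary.PropositionalEquality using (_≡_; _≢_; refl)
open import Relation.Nullary using (¬_; ¬?; contradiction)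
open import Relation.Unary using (Decidable)

record IsPartition (n : ℕ) (μ : List ℕ) : Set where
  field
    positive   : All (1 ≤_) μ
    decreasing : Linked _≥_ μ
    sums       : sum μ ≡ n

Nuclear : List ℕ → Set
Nuclear = All (_≢ 1)

nuclear? : Decidable Nuclear
nuclear? = All.all? (λ k → ¬? (k ≟ 1))

-- All weakly decreasing lists of length at most l with entries in {1, …, m},
-- each listed once.  A partition of n has at most n parts, each at most n.
descending : (l m : ℕ) → List (List ℕ)
descending zero    m       = [ [] ]
descending (suc l) zero    = [ [] ]
descending (suc l) (suc m) =
  descending (suc l) m ++ map (suc m ∷_) (descending l (suc m))

partitions : ℕ → List (List ℕ)
partitions n = filter (λ μ → sum μ ≟ n) (descending n n)

nuclearPartitions : ℕ → List (List ℕ)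
nuclearPartitions n = filter nuclear? (partitions n)

p : ℕ → ℕ
p n = length (partitions n)

ν : ℕ → ℕ
ν n = length (nuclearPartitions n)

nuclearPartitionsExceptSingleton : ℕ → List (List ℕ)
nuclearPartitionsExceptSingleton n =
  filter (λ μ → ¬? (≡-dec _≟_ μ [ n ])) (nuclearPartitions n)

-- μ₁ - μ₂; the subtraction is exact on weakly decreasing lists.  The values on
-- lists with fewer than two parts are junk: for n ≥ 1 no such list is in
-- nuclearPartitionsExceptSingleton n.
firstGap : List ℕ → ℕ
firstGap []          = 0
firstGap (_ ∷ [])    = 0
firstGap (x ∷ y ∷ _) = x ∸ y

private
  Bounded : (m : ℕ) → List ℕ → Set
  Bounded m = All (_≤ m)

  bounded-mono : ∀ {m μ} → Bounded m μ → Bounded (suc m) μ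
  bounded-mono = All.map m≤n⇒m≤1+n

  cons-decreasing : ∀ {m μ} → Bounded m μ → Linked _≥_ μ → Linked _≥_ (m ∷ μ)
  cons-decreasing []      _  = [-]
  cons-decreasing (b ∷ _) ds = b ∷ ds

  tail-bounded : ∀ {x μ} → Linked _≥_ (x ∷ μ) → Bounded x μ
  tail-bounded ds = All.tail (Linked⇒All (λ j≤i k≤j → ≤-trans k≤j j≤i) ≤-refl ds)

  tail-decreasing : ∀ {x μ} → Linked _≥_ (x ∷ μ) → Linked _≥_ μ
  tail-decreasing [-]      = []
  tail-decreasing (_ ∷ ds) = ds

  descending-sound : ∀ l m {μ} → μ ∈ descending l m →
                     All (1 ≤_) μ × Linked _≥_ μ × Bounded m μ
  descending-sound zero    m       (here refl) = [] , [] , []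
  descending-sound (suc l) zero    (here refl) = [] , [] , []
  descending-sound (suc l) (suc m) μ∈ with ∈-++⁻ (descending (suc l) m) μ∈
  ... | inj₁ μ∈ˡ = let ps , ds , bs = descending-sound (suc l) m μ∈ˡ
                   in ps , ds , bounded-mono bs
  ... | inj₂ μ∈ʳ with ∈-map⁻ (suc m ∷_) μ∈ʳ
  ...   | _ , μ′∈ , refl = let ps , ds , bs = descending-sound l (suc m) μ′∈
                           in s≤s z≤n ∷ ps , cons-decreasing bs ds , ≤-refl ∷ bs

  []∈descending : ∀ l m → [] ∈ descending l m
  []∈descending zero    m       = here refl
  []∈descending (suc l) zero    = here refl
  []∈descending (suc l) (suc m) = ∈-++⁺ˡ ([]∈descending (suc l) m)

  descending-complete : ∀ l m {μ} → length μ ≤ l → All (1 ≤_) μ → Linked _≥_ μ →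
                        Bounded m μ → μ ∈ descending l m
  descending-complete l       m {[]}    _  _        _  _        = []∈descending l m
  descending-complete (suc l) zero {x ∷ μ} _ (1≤x ∷ _) _ (x≤0 ∷ _) =
    contradiction (≤-trans 1≤x x≤0) 1+n≰n
  descending-complete (suc l) (suc m) {x ∷ μ} (s≤s len) (1≤x ∷ ps) ds (x≤ ∷ bs)
    with m≤n⇒m<n∨m≡n x≤
  ... | inj₁ x<1+m =
    ∈-++⁺ˡ (descending-complete (suc l) m (s≤s len) (1≤x ∷ ps) ds
      (x≤m ∷ All.map (λ k≤x → ≤-trans k≤x x≤m) (tail-bounded ds)))
    where
    x≤m : x ≤ m
    x≤m = ≤-pred x<1+m
  ... | inj₂ refl = ∈-++⁺ʳ (descending (suc l) m)
    (∈-map⁺ (suc m ∷_) (descending-complete l (suc m) len ps (tail-decreasing ds) bs))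

  descending-unique : ∀ l m → Unique (descending l m)
  descending-unique zero    m       = [] ∷ []
  descending-unique (suc l) zero    = [] ∷ []
  descending-unique (suc l) (suc m) =
    Unique.++⁺ (descending-unique (suc l) m)
               (Unique.map⁺ (λ eq → proj₂ (∷-injective eq)) (descending-unique l (suc m)))
               λ (μ∈ˡ , μ∈ʳ) → disjoint μ∈ˡ (∈-map⁻ (suc m ∷_) μ∈ʳ)
    where
    disjoint : ∀ {μ} → μ ∈ descending (suc l) m → ¬ (∃[ μ′ ] μ′ ∈ descending l (suc m) × μ ≡ suc m ∷ μ′)
    disjoint μ∈ˡ (_ , _ , refl) with descending-sound (suc l) m μ∈ˡ
    ... | _ , _ , 1+m≤m ∷ _ = 1+n≰n 1+m≤m

  length≤sum : ∀ {μ} → All (1 ≤_) μ → length μ ≤ sum μ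
  length≤sum []         = z≤n
  length≤sum (1≤x ∷ ps) = +-mono-≤ 1≤x (length≤sum ps)

  parts≤sum : ∀ μ → Bounded (sum μ) μ
  parts≤sum []      = []
  parts≤sum (x ∷ μ) =
    m≤m+n x (sum μ) ∷ All.map (λ k≤ → ≤-trans k≤ (m≤n+m (sum μ) x)) (parts≤sum μ)

∈-partitions : ∀ {n μ} → μ ∈ partitions n ⇔ IsPartition n μ
∈-partitions {n} {μ} = mk⇔ to from
  where
  to : μ ∈ partitions n → IsPartition n μ
  to μ∈ =
    let μ∈d , sums = ∈-filter⁻ (λ μ → sum μ ≟ n) {xs = descending n n} μ∈
        ps , ds , _ = descending-sound n n μ∈d
    in record { positive = ps ; decreasing = ds ; sums = sums }

  from : IsPartition n μ → μ ∈ partitions n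
  from record { positive = ps ; decreasing = ds ; sums = refl } =
    ∈-filter⁺ (λ μ → sum μ ≟ n)
      (descending-complete n n (length≤sum ps) ps ds (parts≤sum μ)) refl

partitions-unique : ∀ n → Unique (partitions n)
partitions-unique n = Unique.filter⁺ (λ μ → sum μ ≟ n) (descending-unique n n)

∈-nuclearPartitions : ∀ {n μ} → μ ∈ nuclearPartitions n ⇔ (IsPartition n μ × Nuclear μ)
∈-nuclearPartitions {n} = mk⇔
  (λ μ∈ → let μ∈p , nuc = ∈-filter⁻ nuclear? {xs = partitions n} μ∈
          in ∈-partitions .Equivalence.to μ∈p , nuc)
  (λ (isP , nuc) →
    ∈-filter⁺ nuclear? (∈-partitions .Equivalence.from isP) nuc)

nuclearPartitions-unique : ∀ n → Unique (nuclearPartitions n)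
nuclearPartitions-unique n = Unique.filter⁺ nuclear? (partitions-unique n)

{-# OPTIONS --safe #-}
-- Write G n for the sum of μ₁ - μ₂ over the nuclear partitions of n other than
-- (n).  Appending a part 1 identifies the partitions of n with the non-nuclear
-- partitions of n + 1, so p (n + 1) = p n + ν (n + 1).  Raising the largest part
-- by 1 identifies the nuclear partitions of n other than (n) with those of n + 1
-- other than (n + 1) for which μ₁ > μ₂, and it raises each gap by 1, so
-- G (n + 1) = (ν n - 1) + G n.  The formula follows by induction from n = 2.
module Submission where

open import Defs
open import Data.Nat using (ℕ; suc; _+_; _∸_; _≤_; _≥_; _≟_; z≤n; s≤s)
open import Data.Nat.Properties
  using (≤-refl; ≤-trans; ≤-antisym; m≤n⇒m≤1+n; ≰⇒>; _≤?_; m≤n⇒m∸n≡0; +-∸-assoc;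
         +-identityʳ; +-comm; +-suc; suc-injective; <⇒≢; 1+n≢0)
open import Data.Nat.ListAction using (sum)
open import Data.Nat.ListAction.Properties using (sum-++; sum-↭)
open import Data.Nat.Tactic.RingSolver using (solve-∀)
open import Data.List using (List; []; _∷_; [_]; _++_; _∷ʳ_; map; filter; length)
open import Data.List.Properties using (≡-dec; length-++; length-map; map-++; ∷ʳ-injectiveˡ)
open import Data.List.Membership.Propositional using (_∈_)
open import Data.List.Membership.Propositional.Properties
  using (∈-++⁺ˡ; ∈-++⁺ʳ; ∈-++⁻; ∈-map⁺; ∈-map⁻; ∈-filter⁺; ∈-filter⁻)
open import Data.List.Membership.Propositional.Properties.WithK using (unique∧set⇒bag)
open import Data.List.Relation.Binary.BagAndSetEquality using (∼bag⇒↭)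
open import Data.List.Relation.Binary.Permutation.Propositional using (_↭_)
open import Data.List.Relation.Binary.Permutation.Propositional.Properties using (map⁺; ↭-length)
open import Data.List.Relation.Unary.All as All using (All; []; _∷_)
import Data.List.Relation.Unary.All.Properties as All
open import Data.List.Relation.Unary.AllPairs using (_∷_)
open import Data.List.Relation.Unary.Any using (here; there)
open import Data.List.Relation.Unary.Linked using (Linked; []; [-]; _∷_)
open import Data.List.Relation.Unary.Unique.Propositional using (Unique)
import Data.List.Relation.Unary.Unique.Propositional.Properties as Unique
open import Data.Product using (_×_; _,_; ∃-syntax)
open import Data.Sum using (_⊎_; inj₁; inj₂)
open import Function using (_∘_)
open import Function.Bundles using (mk⇔; module Equivalence)
open import Relation.Binary.PropositionalEquality
  using (_≡_; _≢_; refl; sym; trans; cong; cong₂; module ≡-Reasoning)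
open import Relation.Nullary using (¬_; ¬?; yes; no; contradiction)

open Equivalence using (to; from)
open IsPartition

private
  variable
    A : Set
    n : ℕ
    μ : List ℕ

-- Lists without repetitions are fixed up to order by their members. Each bijection below thus
-- reduces to two inclusions, and the permutation then carries over `length` and `sum`.
unique∧sameMembers⇒↭ : {xs ys : List A} → Unique xs → Unique ys →
                       (∀ {x} → x ∈ xs → x ∈ ys) → (∀ {x} → x ∈ ys → x ∈ xs) → xs ↭ ys
unique∧sameMembers⇒↭ uxs uys ⊆ ⊇ = ∼bag⇒↭ (unique∧set⇒bag uxs uys (mk⇔ ⊆ ⊇))

-- Partitions by presence of a part 1

∷ʳ1-decreasing : All (1 ≤_) μ → Linked _≥_ μ → Linked _≥_ (μ ∷ʳ 1)
∷ʳ1-decreasing []         []       = [-]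
∷ʳ1-decreasing (1≤x ∷ []) [-]      = 1≤x ∷ [-]
∷ʳ1-decreasing (_ ∷ ps)   (d ∷ ds) = d ∷ ∷ʳ1-decreasing ps ds

decreasing-∷ʳ⁻ : ∀ {x} μ → Linked _≥_ (μ ∷ʳ x) → Linked _≥_ μ
decreasing-∷ʳ⁻ []          _        = []
decreasing-∷ʳ⁻ (_ ∷ [])    _        = [-]
decreasing-∷ʳ⁻ (_ ∷ _ ∷ _) (d ∷ ds) = d ∷ decreasing-∷ʳ⁻ _ ds

sum-∷ʳ1 : ∀ μ → sum (μ ∷ʳ 1) ≡ suc (sum μ)
sum-∷ʳ1 μ = trans (sum-++ μ [ 1 ]) (+-comm (sum μ) 1)

-- In a weakly decreasing list of positive parts only 1s can follow a 1, so a part 1 occurs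
-- somewhere exactly when the last part is 1.
nuclear⊎endsIn1 : All (1 ≤_) μ → Linked _≥_ μ → Nuclear μ ⊎ ∃[ lam ] μ ≡ lam ∷ʳ 1
nuclear⊎endsIn1 [] [] = inj₁ []
nuclear⊎endsIn1 {x ∷ []} _ [-] with x ≟ 1
... | yes refl = inj₂ ([] , refl)
... | no x≢1   = inj₁ (x≢1 ∷ [])
nuclear⊎endsIn1 {x ∷ _} (_ ∷ ps@(1≤y ∷ _)) (y≤x ∷ ds) with nuclear⊎endsIn1 ps ds
-- A head equal to 1 would force `y` down to 1, against the nuclearity of the tail.
... | inj₁ nuc@(y≢1 ∷ _) = inj₁ ((λ { refl → y≢1 (≤-antisym y≤x 1≤y) }) ∷ nuc)
... | inj₂ (lam , eq)    = inj₂ (x ∷ lam , cong (x ∷_) eq)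

partitions-suc : ∀ n → partitions (suc n) ↭ nuclearPartitions (suc n) ++ map (_∷ʳ 1) (partitions n)
partitions-suc n = unique∧sameMembers⇒↭ (partitions-unique (suc n))
  (Unique.++⁺ (nuclearPartitions-unique (suc n))
              (Unique.map⁺ (∷ʳ-injectiveˡ _ _) (partitions-unique n))
              (λ (μ∈ˡ , μ∈ʳ) → disjoint μ∈ˡ (∈-map⁻ (_∷ʳ 1) μ∈ʳ)))
  split merge
  where
  disjoint : μ ∈ nuclearPartitions (suc n) → ¬ (∃[ lam ] lam ∈ partitions n × μ ≡ lam ∷ʳ 1)
  disjoint μ∈ (lam , _ , refl) with to (∈-nuclearPartitions {suc n}) μ∈
  ... | _ , nuc with All.++⁻ʳ lam nuc
  ...   | 1≢1 ∷ [] = 1≢1 refl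

  split : μ ∈ partitions (suc n) → μ ∈ nuclearPartitions (suc n) ++ map (_∷ʳ 1) (partitions n)
  split μ∈ with to (∈-partitions {suc n}) μ∈
  ... | isP with nuclear⊎endsIn1 (positive isP) (decreasing isP)
  ...   | inj₁ nuc          = ∈-++⁺ˡ (from (∈-nuclearPartitions {suc n}) (isP , nuc))
  ...   | inj₂ (lam , refl) = ∈-++⁺ʳ (nuclearPartitions (suc n)) (∈-map⁺ (_∷ʳ 1) (from (∈-partitions {n}) record
    { positive   = All.++⁻ˡ lam (positive isP)
    ; decreasing = decreasing-∷ʳ⁻ lam (decreasing isP)
    ; sums       = suc-injective (trans (sym (sum-∷ʳ1 lam)) (sums isP))
    }))

  merge : μ ∈ nuclearPartitions (suc n) ++ map (_∷ʳ 1) (partitions n) → μ ∈ partitions (suc n)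
  merge μ∈ with ∈-++⁻ (nuclearPartitions (suc n)) μ∈
  ... | inj₁ μ∈ˡ = let isP , _ = to (∈-nuclearPartitions {suc n}) μ∈ˡ in from (∈-partitions {suc n}) isP
  ... | inj₂ μ∈ʳ with ∈-map⁻ (_∷ʳ 1) μ∈ʳ
  ...   | lam , lam∈ , refl = let isP = to (∈-partitions {n}) lam∈ in from (∈-partitions {suc n}) record
    { positive   = All.∷ʳ⁺ (positive isP) ≤-refl
    ; decreasing = ∷ʳ1-decreasing (positive isP) (decreasing isP)
    ; sums       = trans (sum-∷ʳ1 lam) (cong suc (sums isP))
    }

p-suc : ∀ n → p (suc n) ≡ ν (suc n) + p n
p-suc n = begin
  length (partitions (suc n))
    ≡⟨ ↭-length (partitions-suc n) ⟩
  length (nuclearPartitions (suc n) ++ map (_∷ʳ 1) (partitions n))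
    ≡⟨ length-++ (nuclearPartitions (suc n)) ⟩
  ν (suc n) + length (map (_∷ʳ 1) (partitions n))
    ≡⟨ cong (ν (suc n) +_) (length-map (_∷ʳ 1) (partitions n)) ⟩
  ν (suc n) + p n ∎
  where open ≡-Reasoning

-- Nuclear partitions with at least two parts

exceptSingleton-unique : ∀ n → Unique (nuclearPartitionsExceptSingleton n)
exceptSingleton-unique n = Unique.filter⁺ (λ μ → ¬? (≡-dec _≟_ μ [ n ])) (nuclearPartitions-unique n)

∈-exceptSingleton⁻ : ∀ n → μ ∈ nuclearPartitionsExceptSingleton n → IsPartition n μ × Nuclear μ × μ ≢ [ n ]
∈-exceptSingleton⁻ n μ∈ =
  let μ∈N , μ≢ = ∈-filter⁻ (λ μ → ¬? (≡-dec _≟_ μ [ n ])) {xs = nuclearPartitions n} μ∈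
      isP , nuc = to (∈-nuclearPartitions {n}) μ∈N
  in isP , nuc , μ≢

∈-exceptSingleton⁺ : ∀ n → IsPartition n μ → Nuclear μ → μ ≢ [ n ] → μ ∈ nuclearPartitionsExceptSingleton n
∈-exceptSingleton⁺ n isP nuc μ≢ =
  ∈-filter⁺ (λ μ → ¬? (≡-dec _≟_ μ [ n ])) (from (∈-nuclearPartitions {n}) (isP , nuc)) μ≢

-- The empty list sums to 0 and a single part must equal `n`. Hence the default values of `firstGap`
-- never enter the sum.
atLeastTwoParts : 1 ≤ n → IsPartition n μ → μ ≢ [ n ] → ∃[ x ] ∃[ y ] ∃[ lam ] μ ≡ x ∷ y ∷ lam
atLeastTwoParts {μ = []}          1≤n isP _  = contradiction (sums isP) (<⇒≢ 1≤n)
atLeastTwoParts {μ = x ∷ []}      _   isP μ≢ =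
  contradiction (cong [_] (trans (sym (+-identityʳ x)) (sums isP))) μ≢
atLeastTwoParts {μ = x ∷ y ∷ lam} _   _   _  = x , y , lam , refl

-- Makes `ν n` a successor, which resolves the truncated `∸ 1` in the theorem. The bound is what
-- makes `[ n ]` itself nuclear.
nuclearPartitions-singleton : 2 ≤ n → nuclearPartitions n ↭ [ n ] ∷ nuclearPartitionsExceptSingleton n
nuclearPartitions-singleton {n} 2≤n = unique∧sameMembers⇒↭ (nuclearPartitions-unique n)
  (All.tabulate (λ { μ∈ refl → let _ , _ , μ≢ = ∈-exceptSingleton⁻ n μ∈ in μ≢ refl })
    ∷ exceptSingleton-unique n)
  split merge
  where
  split : μ ∈ nuclearPartitions n → μ ∈ [ n ] ∷ nuclearPartitionsExceptSingleton n
  split {μ} μ∈ with ≡-dec _≟_ μ [ n ]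
  ... | yes refl = here refl
  ... | no μ≢    = let isP , nuc = to (∈-nuclearPartitions {n}) μ∈ in there (∈-exceptSingleton⁺ n isP nuc μ≢)

  merge : μ ∈ [ n ] ∷ nuclearPartitionsExceptSingleton n → μ ∈ nuclearPartitions n
  merge (here refl) = from (∈-nuclearPartitions {n})
    ( record { positive = ≤-trans (s≤s z≤n) 2≤n ∷ [] ; decreasing = [-] ; sums = +-identityʳ n }
    , <⇒≢ 2≤n ∘ sym ∷ [])
  merge (there μ∈)  = let isP , nuc , _ = ∈-exceptSingleton⁻ n μ∈ in from (∈-nuclearPartitions {n}) (isP , nuc)

-- Raising the largest part

raiseFirst : List ℕ → List ℕ
raiseFirst []       = []
raiseFirst (x ∷ xs) = suc x ∷ xs

-- Holds on all lists, since `[]` is fixed and no nonempty list is sent to it.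
raiseFirst-injective : ∀ {xs ys} → raiseFirst xs ≡ raiseFirst ys → xs ≡ ys
raiseFirst-injective {[]}    {[]}    refl = refl
raiseFirst-injective {_ ∷ _} {_ ∷ _} refl = refl

-- For positive `n`, the partitions with μ₁ = μ₂: those that `raiseFirst` cannot reach.
flatExceptSingleton : ℕ → List (List ℕ)
flatExceptSingleton n = filter (λ μ → firstGap μ ≟ 0) (nuclearPartitionsExceptSingleton n)

firstGap-raiseFirst : 1 ≤ n → μ ∈ nuclearPartitionsExceptSingleton n →
                      firstGap (raiseFirst μ) ≡ suc (firstGap μ)
firstGap-raiseFirst {n} 1≤n μ∈ with ∈-exceptSingleton⁻ n μ∈
... | isP , _ , μ≢ with atLeastTwoParts 1≤n isP μ≢ | decreasing isP
-- Truncated subtraction commutes with `suc` here because `y≤x` makes it exact.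
...   | _ , _ , _ , refl | y≤x ∷ _ = +-∸-assoc 1 y≤x

-- When μ₁ > μ₂, lowering μ₁ by 1 preserves the order, and the new first part is at least μ₂ ≥ 2, so
-- the result is still nuclear. At `n = 0` the empty partition has no part to raise.
exceptSingleton-suc : 1 ≤ n → nuclearPartitionsExceptSingleton (suc n) ↭
                      flatExceptSingleton (suc n) ++ map raiseFirst (nuclearPartitionsExceptSingleton n)
exceptSingleton-suc {n} 1≤n = unique∧sameMembers⇒↭ (exceptSingleton-unique (suc n))
  (Unique.++⁺ (Unique.filter⁺ flat? (exceptSingleton-unique (suc n)))
              (Unique.map⁺ raiseFirst-injective (exceptSingleton-unique n))
              (λ (μ∈ˡ , μ∈ʳ) → disjoint μ∈ˡ (∈-map⁻ raiseFirst μ∈ʳ)))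
  split merge
  where
  flat? = λ μ → firstGap μ ≟ 0

  disjoint : μ ∈ flatExceptSingleton (suc n) →
             ¬ (∃[ lam ] lam ∈ nuclearPartitionsExceptSingleton n × μ ≡ raiseFirst lam)
  disjoint μ∈ (lam , lam∈ , refl) =
    let _ , flat = ∈-filter⁻ flat? {xs = nuclearPartitionsExceptSingleton (suc n)} μ∈
    in 1+n≢0 (trans (sym (firstGap-raiseFirst 1≤n lam∈)) flat)

  split : μ ∈ nuclearPartitionsExceptSingleton (suc n) →
          μ ∈ flatExceptSingleton (suc n) ++ map raiseFirst (nuclearPartitionsExceptSingleton n)
  split μ∈ with ∈-exceptSingleton⁻ (suc n) μ∈
  ... | isP , nuc , μ≢ with atLeastTwoParts (s≤s z≤n) isP μ≢
  ...   | x , y , lam , refl with x ≤? y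
  ...     | yes x≤y = ∈-++⁺ˡ (∈-filter⁺ flat? μ∈ (m≤n⇒m∸n≡0 x≤y))
  ...     | no x≰y with ≰⇒> x≰y | positive isP | nuc | decreasing isP
  -- Here `x` is `suc x′`. If the lowered part `x′` were 1, then `y` would be 1 as well; and two
  -- parts remain, so the result is not `[ n ]`.
  ...       | s≤s {n = x′} y≤x′ | _ ∷ ps@(1≤y ∷ _) | _ ∷ nucs@(y≢1 ∷ _) | _ ∷ ds =
    ∈-++⁺ʳ (flatExceptSingleton (suc n)) (∈-map⁺ raiseFirst (∈-exceptSingleton⁺ n
      (record
        { positive   = ≤-trans 1≤y y≤x′ ∷ ps
        ; decreasing = y≤x′ ∷ ds
        ; sums       = suc-injective (sums isP)
        })
      ((λ { refl → y≢1 (≤-antisym y≤x′ 1≤y) }) ∷ nucs)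
      (λ ())))

  merge : μ ∈ flatExceptSingleton (suc n) ++ map raiseFirst (nuclearPartitionsExceptSingleton n) →
          μ ∈ nuclearPartitionsExceptSingleton (suc n)
  merge μ∈ with ∈-++⁻ (flatExceptSingleton (suc n)) μ∈
  ... | inj₁ μ∈ˡ =
    let μ∈E , _ = ∈-filter⁻ flat? {xs = nuclearPartitionsExceptSingleton (suc n)} μ∈ˡ in μ∈E
  ... | inj₂ μ∈ʳ with ∈-map⁻ raiseFirst μ∈ʳ
  ...   | _ , lam∈ , refl with ∈-exceptSingleton⁻ n lam∈
  ...     | isP , nuc , lam≢ with atLeastTwoParts 1≤n isP lam≢ | positive isP | nuc | decreasing isP
  ...       | _ , _ , _ , refl | 1≤x ∷ ps | _ ∷ nucs | y≤x ∷ ds = ∈-exceptSingleton⁺ (suc n)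
    (record
      { positive   = s≤s z≤n ∷ ps
      ; decreasing = m≤n⇒m≤1+n y≤x ∷ ds
      ; sums       = cong suc (sums isP)
      })
    (<⇒≢ (s≤s 1≤x) ∘ sym ∷ nucs)
    (λ ())

-- Sums of first gaps

sum-map-0 : ∀ {f : A → ℕ} {xs} → All (λ x → f x ≡ 0) xs → sum (map f xs) ≡ 0
sum-map-0 []         = refl
sum-map-0 (eq ∷ eqs) = cong₂ _+_ eq (sum-map-0 eqs)

sum-map-suc : ∀ {g : A → A} {f : A → ℕ} {xs} → All (λ x → f (g x) ≡ suc (f x)) xs →
              sum (map f (map g xs)) ≡ length xs + sum (map f xs)
sum-map-suc [] = refl
sum-map-suc {f = f} {xs = x ∷ xs} (eq ∷ eqs) =
  trans (cong₂ _+_ eq (sum-map-suc eqs)) (rearrange (f x) (length xs) (sum (map f xs)))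
  where
  rearrange : ∀ a b c → suc a + (b + c) ≡ suc b + (a + c)
  rearrange = solve-∀

gapSum : ℕ → ℕ
gapSum n = sum (map firstGap (nuclearPartitionsExceptSingleton n))

gapSum-suc : 1 ≤ n → gapSum (suc n) ≡ length (nuclearPartitionsExceptSingleton n) + gapSum n
gapSum-suc {n} 1≤n = begin
  sum (map firstGap (nuclearPartitionsExceptSingleton (suc n)))
    ≡⟨ sum-↭ (map⁺ firstGap (exceptSingleton-suc 1≤n)) ⟩
  sum (map firstGap (flat ++ raised))
    ≡⟨ cong sum (map-++ firstGap flat raised) ⟩
  sum (map firstGap flat ++ map firstGap raised)
    ≡⟨ sum-++ (map firstGap flat) (map firstGap raised) ⟩
  sum (map firstGap flat) + sum (map firstGap raised)
    -- Flat partitions contribute nothing; each raised one contributes its old gap plus 1.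
    ≡⟨ cong₂ _+_ (sum-map-0 (All.all-filter (λ μ → firstGap μ ≟ 0) (nuclearPartitionsExceptSingleton (suc n))))
                 (sum-map-suc (All.tabulate (firstGap-raiseFirst 1≤n))) ⟩
  length (nuclearPartitionsExceptSingleton n) + gapSum n ∎
  where
  open ≡-Reasoning
  flat   = flatExceptSingleton (suc n)
  raised = map raiseFirst (nuclearPartitionsExceptSingleton n)

theorem1 : ∀ (n : ℕ) → n ≥ 2 →
    p n ≡ n + ν n ∸ 1 + sum (map firstGap (nuclearPartitionsExceptSingleton n))
theorem1 1 (s≤s ())
-- Both sides evaluate to 2, the sum being empty. The induction cannot start at 1, where the right
-- side is 0 but `p 1` is 1.
theorem1 2 _ = refl
theorem1 (suc m@(suc (suc _))) (s≤s 1≤m) = begin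
  p (suc m)                                        ≡⟨ p-suc m ⟩
  ν (suc m) + p m                                  ≡⟨ cong (ν (suc m) +_) (theorem1 m 2≤m) ⟩
  -- Replacing `ν m` by `suc e` exposes a successor for `∸ 1` to cancel.
  ν (suc m) + (m + ν m ∸ 1 + gapSum m)             ≡⟨ cong (λ k → ν (suc m) + (m + k ∸ 1 + gapSum m))
                                                           (↭-length (nuclearPartitions-singleton 2≤m)) ⟩
  ν (suc m) + (m + suc e ∸ 1 + gapSum m)           ≡⟨ cong (λ k → ν (suc m) + (k ∸ 1 + gapSum m)) (+-suc m e) ⟩
  ν (suc m) + (m + e + gapSum m)                   ≡⟨ rearrange (ν (suc m)) m e (gapSum m) ⟩
  -- `m + ν (suc m)` is `suc m + ν (suc m) ∸ 1` by computation, so only the gap sum needs rewriting.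
  m + ν (suc m) + (e + gapSum m)                   ≡⟨ cong (m + ν (suc m) +_) (gapSum-suc 1≤m) ⟨
  suc m + ν (suc m) ∸ 1 + gapSum (suc m)           ∎
  where
  open ≡-Reasoning
  e = length (nuclearPartitionsExceptSingleton m)

  2≤m : 2 ≤ m
  2≤m = s≤s (s≤s z≤n)

  rearrange : ∀ a b c d → a + (b + c + d) ≡ b + a + (c + d)
  rearrange = solve-∀
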